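{- For every integer $k\geq 2$, $$r(K_3,K_3:k)=3k+2.$$ That is, $3k+2$ is the least number $p$ of vertices such that every red-blue coloring of the edges of the complete graph $K_p$ contains at least $k$ pairwise vertex-disjoint monochromatic triangles (each triangle being red or blue, and different triangles being allowed to have different colors).
   Context: Graphs are finite and simple. A $2$-coloring of a graph assigns to each edge one of the colors red, blue. A subgraph is monochromatic if all its edges have the same color. Two subgraphs are disjoint if they share no vertex. For graphs $G_1,G_2$ and a positive integer $k$, $r(G_1,G_2:k)$ denotes the least number $p$ of vertices such that every $2$-coloring of the edges of $K_p$ contains a total of at least $k$ pairwise disjoint subgraphs each of which is either red and isomorphic to $G_1$ or blue and isomorphic to $G_2$. -}

module Defs where

open import Data.Fin using (Fin)
open import Data.Fin.Properties using (_≟_)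
open import Data.Nat using (ℕ; _≤_)
open import Data.Product using (Σ-syntax; ∃-syntax; _×_; _,_)
open import Data.Sum using (_⊎_; inj₁; inj₂)
open import Function using (_∘_)
open import Function.Definitions using (Injective)
open import Level using (0ℓ)
open import Relation.Binary using (Rel; Symmetric; Irreflexive; Decidable)
open import Relation.Binary.PropositionalEquality using (_≡_; _≢_; sym)
open import Relation.Nullary.Decidable using (¬?)
open import Relation.Unary using (Pred; _⊥_)

record Graph : Set₁ where
  field
    order  : ℕ
    Adj    : Rel (Fin order) 0ℓ
    symm   : Symmetric Adj
    irrefl : Irreflexive _≡_ Adj
    adj?   : Decidable Adj

  Vertex : Set
  Vertex = Fin order

open Graph

K : ℕ → Graph
K n = record
  { order  = n
  ; Adj    = _≢_
  ; symm   = λ u≢v → u≢v ∘ sym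
  ; irrefl = λ u≡v u≢v → u≢v u≡v
  ; adj?   = λ u v → ¬? (u ≟ v)
  }

data Color : Set where
  red blue : Color

-- The adjacency proof is irrelevant, so a color belongs to the pair of
-- endpoints and not to a particular proof of adjacency; color-sym makes it
-- belong to the unordered pair, i.e. to the edge.
record Coloring (G : Graph) : Set where
  field
    color     : ∀ u v → .(Adj G u v) → Color
    color-sym : ∀ u v (e : Adj G u v) → color u v e ≡ color v u (symm G e)

open Coloring

-- A subgraph of H isomorphic to G (not necessarily induced), presented by the
-- isomorphism from G onto it: the subgraph has vertices embed u and edges
-- {embed u, embed v} for the edges {u, v} of G.
record Copy (G H : Graph) : Set where
  field
    embed     : Vertex G → Vertex H
    injective : Injective _≡_ _≡_ embed
    preserves : ∀ {u v} → Adj G u v → Adj H (embed u) (embed v)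

open Copy

VertexSet : ∀ {G H} → Copy G H → Pred (Vertex H) 0ℓ
VertexSet S w = ∃[ u ] embed S u ≡ w

HasColor : ∀ {G H} → Coloring H → Color → Copy G H → Set
HasColor {G} χ a S =
  ∀ {u v} (e : Adj G u v) → color χ (embed S u) (embed S v) (preserves S e) ≡ a

ColoredCopy : ∀ {H} → Graph → Graph → Coloring H → Set
ColoredCopy {H} G₁ G₂ χ =
  (Σ[ S ∈ Copy G₁ H ] HasColor χ red S) ⊎ (Σ[ S ∈ Copy G₂ H ] HasColor χ blue S)

coloredVertexSet : ∀ {H G₁ G₂} (χ : Coloring H) →
                   ColoredCopy G₁ G₂ χ → Pred (Vertex H) 0ℓ
coloredVertexSet _ (inj₁ (S , _)) = VertexSet S
coloredVertexSet _ (inj₂ (S , _)) = VertexSet S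

-- "At least k pairwise disjoint subgraphs" is a disjoint family indexed by
-- Fin k; its members are automatically distinct when G₁ and G₂ have vertices.
HasDisjointCopies : ∀ {H} → Graph → Graph → ℕ → Coloring H → Set
HasDisjointCopies G₁ G₂ k χ =
  Σ[ F ∈ (Fin k → ColoredCopy G₁ G₂ χ) ]
    (∀ i j → i ≢ j → coloredVertexSet χ (F i) ⊥ coloredVertexSet χ (F j))

Forces : Graph → Graph → ℕ → ℕ → Set
Forces G₁ G₂ k p = (χ : Coloring (K p)) → HasDisjointCopies G₁ G₂ k χ

-- p = r(G₁, G₂ : k). Stated as a relation, since the existence of the least
-- such p is itself a theorem.
r[_,_∶_]≡_ : Graph → Graph → ℕ → ℕ → Set
r[ G₁ , G₂ ∶ k ]≡ p =
  Forces G₁ G₂ k p × (∀ q → Forces G₁ G₂ k q → p ≤ q)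

{-# OPTIONS --safe #-}

-- Upper bound: six vertices always span a monochromatic triangle, so deleting
-- the vertices of one reduces k to k − 1 and the order by 3, down to k = 2.
-- In a coloring of K₈ we label a monochromatic triangle by 0, 1, 2 and split on
-- the colors of the remaining edges one at a time, closing a branch as soon as
-- two disjoint monochromatic triangles appear.
-- Lower bound: color the edges between {0, 1} and the other vertices blue and
-- all others red. Every monochromatic triangle avoids 0 and 1, so k disjoint
-- ones need 3k further vertices.
module Submission where

open import Defs
open import Data.Bool using (Bool; true; false; T; if_then_else_; _∧_; _∨_)
open import Data.Bool.ListAction using (any)
open import Data.Bool.Properties using (T-∧; T-∨; ¬-not)
open import Data.Empty using (⊥-elim)
open import Data.Fin
  using (Fin; zero; suc; #_; _↑ˡ_; _↑ʳ_; combine; join;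
         punchIn; punchOut; remQuot; splitAt)
open import Data.Fin.Properties
  using (_≟_; combine-remQuot; injective⇒≤; punchIn-injective; punchInᵢ≢i; punchIn-punchOut;
         punchOut-injective; suc-injective; ↑ˡ-injective; join-splitAt)
open import Data.List using (List; []; _∷_; _++_; allFin; cartesianProduct; map)
open import Data.List.Relation.Unary.All as All using (All; []; _∷_)
open import Data.List.Relation.Unary.All.Properties using (++⁺; map⁺)
open import Data.List.Relation.Unary.Any.Properties using (any⁻)
open import Data.Maybe using (Maybe; just; nothing)
open import Data.Nat using (ℕ; zero; suc; _+_; _*_; _≤_; _≥_; z≤n; s≤s)
open import Data.Nat.Properties using (+-comm; ≤-trans; ≤-reflexive)
open import Data.Nat.Tactic.RingSolver using (solve-∀)
open import Data.Product using (Σ-syntax; ∃-syntax; _×_; _,_; proj₁; proj₂; uncurry)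
open import Data.Sum using (_⊎_; inj₁; inj₂; [_,_])
open import Data.Unit using (tt)
open import Data.Vec using (Vec; []; _∷_; lookup; replicate; updateAt)
open import Data.Vec.Properties using (lookup∘updateAt; lookup∘updateAt′; lookup-replicate)
open import Function using (_∘_; id)
open import Function.Bundles using (Equivalence)
open import Function.Definitions using (Injective)
open import Relation.Binary.PropositionalEquality
  using (_≡_; _≢_; refl; sym; trans; cong; subst; ≢-sym; module ≡-Reasoning)
open import Relation.Nullary using (yes; no; ¬?)
open import Relation.Nullary.Decidable using (decidable-stable; toWitness)
open import Relation.Unary using (_⊆_; _⊥_)

open Graph
open Coloring
open Copy

-- Copies and colorings

copy : ∀ {m n} (f : Fin m → Fin n) → Injective _≡_ _≡_ f → Copy (K m) (K n)
copy f inj = record { embed = f ; injective = inj ; preserves = λ u≢v → u≢v ∘ inj }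

infixr 9 _∘ᶜ_

_∘ᶜ_ : ∀ {G H J} → Copy H J → Copy G H → Copy G J
S ∘ᶜ R = record
  { embed     = embed S ∘ embed R
  ; injective = injective R ∘ injective S
  ; preserves = preserves S ∘ preserves R
  }

pull : ∀ {G H} → Copy G H → Coloring H → Coloring G
pull S χ = record
  { color     = λ u v e → color χ (embed S u) (embed S v) (preserves S e)
  ; color-sym = λ u v e → color-sym χ (embed S u) (embed S v) (preserves S e)
  }

module _ {G H : Graph} (χ : Coloring H) where

  monochromatic : ColoredCopy G G χ → ∃[ a ] Σ[ S ∈ Copy G H ] HasColor χ a S
  monochromatic (inj₁ (S , h)) = red  , S , h
  monochromatic (inj₂ (S , h)) = blue , S , h

  underlying : ColoredCopy G G χ → Copy G H
  underlying S = proj₁ (proj₂ (monochromatic S))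

  -- `coloredVertexSet` and `underlying` both split on the color, so neither reduces on a variable
  -- copy; once the color is known, this inclusion and its converse are `id`.
  coloredVertexSet⊆underlying : ∀ S → coloredVertexSet χ S ⊆ VertexSet (underlying S)
  coloredVertexSet⊆underlying (inj₁ _) = id
  coloredVertexSet⊆underlying (inj₂ _) = id

  underlying⊆coloredVertexSet : ∀ S → VertexSet (underlying S) ⊆ coloredVertexSet χ S
  underlying⊆coloredVertexSet (inj₁ _) = id
  underlying⊆coloredVertexSet (inj₂ _) = id

module _ {G₁ G₂ G H : Graph} (S : Copy G H) (χ : Coloring H) where

  -- `pull S χ` reads its colors off `χ` along `S`, so the same color proof `h` serves the composite
  -- copy.
  push : ColoredCopy G₁ G₂ (pull S χ) → ColoredCopy G₁ G₂ χ
  push (inj₁ (R , h)) = inj₁ (S ∘ᶜ R , h)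
  push (inj₂ (R , h)) = inj₂ (S ∘ᶜ R , h)

  push-vertex : ∀ R {w} → coloredVertexSet χ (push R) w →
                ∃[ x ] embed S x ≡ w × coloredVertexSet (pull S χ) R x
  push-vertex (inj₁ (R , _)) (u , eq) = embed R u , eq , u , refl
  push-vertex (inj₂ (R , _)) (u , eq) = embed R u , eq , u , refl

  push-⊆ : ∀ R → coloredVertexSet χ (push R) ⊆ VertexSet S
  push-⊆ R p with x , eq , _ ← push-vertex R p = x , eq

  push-⊥ : ∀ R R′ → coloredVertexSet (pull S χ) R ⊥ coloredVertexSet (pull S χ) R′ →
           coloredVertexSet χ (push R) ⊥ coloredVertexSet χ (push R′)
  push-⊥ R R′ dis (p , p′)
    with x , eq , q ← push-vertex R p | x′ , eq′ , q′ ← push-vertex R′ p′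
    with refl ← injective S (trans eq (sym eq′)) = dis (q , q′)

  pushAll : ∀ {k} → HasDisjointCopies G₁ G₂ k (pull S χ) → HasDisjointCopies G₁ G₂ k χ
  pushAll (F , dis) = push ∘ F , λ i j i≢j → push-⊥ (F i) (F j) (dis i j i≢j)

module _ {G₁ G₂ H : Graph} {χ : Coloring H} where

  none : HasDisjointCopies G₁ G₂ 0 χ
  none = (λ ()) , λ ()

  cons : ∀ {k} (S : ColoredCopy G₁ G₂ χ) (D : HasDisjointCopies G₁ G₂ k χ) →
         (∀ i → coloredVertexSet χ S ⊥ coloredVertexSet χ (proj₁ D i)) →
         HasDisjointCopies G₁ G₂ (suc k) χ
  cons {k} S (F , dis) S⊥ = F′ , dis′
    where
    F′ : Fin (suc k) → ColoredCopy G₁ G₂ χ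
    F′ zero    = S
    F′ (suc i) = F i

    dis′ : ∀ i j → i ≢ j → coloredVertexSet χ (F′ i) ⊥ coloredVertexSet χ (F′ j)
    dis′ zero    zero    i≢j     = ⊥-elim (i≢j refl)
    dis′ zero    (suc j) _       = S⊥ j
    dis′ (suc i) zero    _ (p , q) = S⊥ i (q , p)
    dis′ (suc i) (suc j) i≢j     = dis i j (i≢j ∘ cong suc)

-- Induction on `m`: delete `v`, the first vertex of `S`. `punchOut` carries the other vertices of
-- `S` into the smaller complete graph, and `punchIn v` brings their complement back while missing
-- `v`.
complement : ∀ m {n} (S : Copy (K m) (K (m + n))) →
             Σ[ S′ ∈ Copy (K n) (K (m + n)) ] VertexSet S ⊥ VertexSet S′
complement zero        S = copy id id , λ { ((() , _) , _) }
complement (suc m) {n} S = copy (punchIn v) (punchIn-injective v _ _) ∘ᶜ R′ , dis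
  where
  v : Fin (suc (m + n))
  v = embed S zero

  v≢ : ∀ i → v ≢ embed S (suc i)
  v≢ i eq with () ← injective S eq

  R : Copy (K m) (K (m + n))
  R = copy (λ i → punchOut (v≢ i)) (λ {i} {j} →
    suc-injective ∘ injective S ∘ punchOut-injective (v≢ i) (v≢ j))

  R′ : Copy (K n) (K (m + n))
  R′ = proj₁ (complement m R)

  dis : VertexSet S ⊥ VertexSet (copy (punchIn v) (punchIn-injective v _ _) ∘ᶜ R′)
  dis ((zero  , eq) , j , eq′) = punchInᵢ≢i v (embed R′ j) (trans eq′ (sym eq))
  dis ((suc i , eq) , j , eq′) = proj₂ (complement m R) ((i , R≡R′) , j , refl)
    where
    R≡R′ : embed R i ≡ embed R′ j
    R≡R′ = punchIn-injective v _ _ (trans (punchIn-punchOut (v≢ i)) (trans eq (sym eq′)))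

-- Applied to a triangle and its complement in `K 8`, this is the relabeling that turns the triangle
-- into 0, 1, 2.
union : ∀ {m n p} (S : Copy (K m) (K p)) (S′ : Copy (K n) (K p)) →
        VertexSet S ⊥ VertexSet S′ → Copy (K (m + n)) (K p)
union {m} {n} {p} S S′ dis = copy (f ∘ splitAt m) λ {i} {j} eq →
  trans (sym (join-splitAt m n i)) (trans (cong (join m n) (f-injective (splitAt m i) (splitAt m j) eq))
                                 (join-splitAt m n j))
  where
  f : Fin m ⊎ Fin n → Fin p
  f = [ embed S , embed S′ ]

  f-injective : ∀ x y → f x ≡ f y → x ≡ y
  f-injective (inj₁ i) (inj₁ j) eq = cong inj₁ (injective S eq)
  f-injective (inj₁ i) (inj₂ j) eq = ⊥-elim (dis ((i , eq) , j , refl))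
  f-injective (inj₂ i) (inj₁ j) eq = ⊥-elim (dis ((j , sym eq) , i , refl))
  f-injective (inj₂ i) (inj₂ j) eq = cong inj₂ (injective S′ eq)

-- Triangles in partial colorings

Triple : ℕ → Set
Triple n = Vec (Fin n) 3

-- Booleans instead of decidability proofs: the search visits thousands of
-- partial colorings, and carrying proofs along makes its evaluation far slower.

distinct : ∀ {n} → Fin n → Fin n → Bool
distinct zero    zero    = false
distinct (suc i) (suc j) = distinct i j
distinct _       _       = true

avoids : ∀ {n k} → Fin n → Vec (Fin n) k → Bool
avoids u []       = true
avoids u (v ∷ vs) = distinct u v ∧ avoids u vs

disjoint : ∀ {n k l} → Vec (Fin n) k → Vec (Fin n) l → Bool
disjoint []       vs = true
disjoint (u ∷ us) vs = avoids u vs ∧ disjoint us vs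

distinct-sound : ∀ {n} (i j : Fin n) → T (distinct i j) → i ≢ j
distinct-sound (suc i) (suc i) d refl = distinct-sound i i d refl

avoids-sound : ∀ {n k} u (vs : Vec (Fin n) k) → T (avoids u vs) → ∀ j → u ≢ lookup vs j
avoids-sound u (v ∷ vs) t zero    = distinct-sound u v (proj₁ (Equivalence.to T-∧ t))
avoids-sound u (v ∷ vs) t (suc j) =
  avoids-sound u vs (proj₂ (Equivalence.to (T-∧ {distinct u v}) t)) j

disjoint-sound : ∀ {n k l} (us : Vec (Fin n) k) (vs : Vec (Fin n) l) → T (disjoint us vs) →
                 ∀ i j → lookup us i ≢ lookup vs j
disjoint-sound (u ∷ us) vs t zero    = avoids-sound u vs (proj₁ (Equivalence.to T-∧ t))
disjoint-sound (u ∷ us) vs t (suc i) =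
  disjoint-sound us vs (proj₂ (Equivalence.to (T-∧ {avoids u vs}) t)) i

-- In matrix form, the triangles on an edge are found by comparing two rows. `nothing` marks an
-- undecided edge; `setEdge` writes both symmetric entries.
PartialColoring : ℕ → Set
PartialColoring n = Vec (Vec (Maybe Color) n) n

uncolored : ∀ {n} → PartialColoring n
uncolored = replicate _ (replicate _ nothing)

set : ∀ {n} → Color → Fin n → Fin n → PartialColoring n → PartialColoring n
set a u v M = updateAt M u (λ r → updateAt r v (λ _ → just a))

setEdge : ∀ {n} → Color → Fin n → Fin n → PartialColoring n → PartialColoring n
setEdge a u v = set a u v ∘ set a v u

bothColored : Color → Maybe Color → Maybe Color → Bool
bothColored red  (just red)  (just red)  = true
bothColored blue (just blue) (just blue) = true
bothColored _    _           _           = false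

-- `ι` carries a position in the remaining rows back to the vertex it stands for.
apexes : ∀ {n m} → (Fin n → Fin m) → Color → Vec (Maybe Color) n → Vec (Maybe Color) n → List (Fin m)
apexes ι a []       []       = []
apexes ι a (x ∷ xs) (y ∷ ys) =
  if bothColored a x y then ι zero ∷ apexes (ι ∘ suc) a xs ys else apexes (ι ∘ suc) a xs ys

newTriangles : ∀ {n} → Color → Fin n → Fin n → PartialColoring n → List (Triple n)
newTriangles a u v M = map (λ w → u ∷ v ∷ w ∷ []) (apexes id a (lookup M u) (lookup M v))

-- Exhaustive search over edge colorings

module Search {n} (goal : Triple n → List (Triple n) → Bool) where

  search : List (Fin n × Fin n) → PartialColoring n → List (Triple n) → Bool
  branch : Color → Fin n → Fin n → List (Fin n × Fin n) → PartialColoring n → List (Triple n) → Bool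

  -- A full coloring in which the goal was never reached leaves the branch open.
  search []             M ts = false
  search ((u , v) ∷ es) M ts = branch red u v es M ts ∧ branch blue u v es M ts

  branch a u v es M ts =
    -- Triangles completed by the same edge share it, so when disjointness is the goal, comparing
    -- the new ones with the earlier `ts` is enough.
    any (λ t → goal t ts) (newTriangles a u v M) ∨
    search es (setEdge a u v M) (newTriangles a u v M ++ ts)

-- Edges within the tail precede those at `x`, so the search finishes one complete subgraph before
-- it adds the next vertex.
pairs : ∀ {A : Set} → List A → List (A × A)
pairs []       = []
pairs (x ∷ xs) = pairs xs ++ map (x ,_) xs

edges₆ : List (Fin 6 × Fin 6)
edges₆ = pairs (allFin 6)

-- The edges among 3, …, 7 come first: unless they contain a monochromatic
-- triangle, they form a pentagon in each color, which leaves few branches.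
edges₈ : List (Fin 8 × Fin 8)
edges₈ = pairs (map (3 ↑ʳ_) (allFin 5)) ++ cartesianProduct (map (_↑ˡ 5) (allFin 3)) (map (3 ↑ʳ_) (allFin 5))

triangle₈ : Color → PartialColoring 8
triangle₈ a = setEdge a (# 0) (# 1) (setEdge a (# 0) (# 2) (setEdge a (# 1) (# 2) uncolored))

012₈ : Triple 8
012₈ = # 0 ∷ # 1 ∷ # 2 ∷ []

anyTriangle disjointFromOne : ∀ {n} → Triple n → List (Triple n) → Bool
anyTriangle     _ _  = true
disjointFromOne t ts = any (disjoint t) ts

search₆ : T (Search.search anyTriangle edges₆ uncolored [])
search₆ = tt

-- Both colors of the first triangle are evaluated, in place of an argument by color symmetry.
search₈ : ∀ a → T (Search.search disjointFromOne edges₈ (triangle₈ a) (012₈ ∷ []))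
search₈ red  = tt
search₈ blue = tt

-- Soundness of the search

module _ {n} (χ : Coloring (K n)) where

  -- The inequality is bundled in because `color` asks for it; it also makes the vertices of a
  -- `MonoIn` triple distinct.
  Colored : Color → Fin n → Fin n → Set
  Colored a u v = Σ[ u≢v ∈ u ≢ v ] color χ u v u≢v ≡ a

  MonoIn : Color → Triple n → Set
  MonoIn a (u ∷ v ∷ w ∷ []) = Colored a u v × Colored a u w × Colored a v w

  Mono : Triple n → Set
  Mono t = ∃[ a ] MonoIn a t

  record Extends (M : PartialColoring n) : Set where
    constructor extends
    field colored : ∀ u v {a} → lookup (lookup M u) v ≡ just a → Colored a u v

module _ {n} {χ : Coloring (K n)} where

  Colored-sym : ∀ {a u v} → Colored χ a u v → Colored χ a v u
  Colored-sym (u≢v , refl) = ≢-sym u≢v , sym (color-sym χ _ _ u≢v)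

  uncolored-extends : Extends χ uncolored
  uncolored-extends = extends λ u v eq → impossible u v (trans (sym eq) (uncolored-lookup u v))
    where
    uncolored-lookup : ∀ u v → lookup (lookup uncolored u) v ≡ nothing
    uncolored-lookup u v =
      trans (cong (λ r → lookup r v) (lookup-replicate u (replicate n nothing))) (lookup-replicate v nothing)

    impossible : ∀ u v {a} → just a ≡ nothing → Colored χ a u v
    impossible _ _ ()

  set-extends : ∀ {a u v M} → Colored χ a u v → Extends χ M → Extends χ (set a u v M)
  set-extends {a} {u} {v} {M} c (extends col) = extends col′
    where
    col′ : ∀ x y {b} → lookup (lookup (set a u v M) x) y ≡ just b → Colored χ b x y
    col′ x y eq with x ≟ u
    ... | no x≢u rewrite lookup∘updateAt′ x u {λ r → updateAt r v (λ _ → just a)} x≢u M = col x y eq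
    ... | yes refl rewrite lookup∘updateAt u {λ r → updateAt r v (λ _ → just a)} M with y ≟ v
    ...   | no y≢v rewrite lookup∘updateAt′ y v {λ _ → just a} y≢v (lookup M u) = col u y eq
    ...   | yes refl rewrite lookup∘updateAt v {λ _ → just a} (lookup M u) with refl ← eq = c

  setEdge-extends : ∀ {a u v M} → Colored χ a u v → Extends χ M → Extends χ (setEdge a u v M)
  setEdge-extends c ext = set-extends c (set-extends (Colored-sym c) ext)

  bothColored-sound : ∀ a x y → bothColored a x y ≡ true → x ≡ just a × y ≡ just a
  bothColored-sound red  (just red)  (just red)  _ = refl , refl
  bothColored-sound blue (just blue) (just blue) _ = refl , refl

  apexes-sound : ∀ {m} {P : Fin m → Set} {k} (ι : Fin k → Fin m) a xs ys →
                 (∀ i → lookup xs i ≡ just a → lookup ys i ≡ just a → P (ι i)) →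
                 All P (apexes ι a xs ys)
  apexes-sound ι a []       []       p = []
  apexes-sound ι a (x ∷ xs) (y ∷ ys) p with bothColored a x y in eq
  ... | false = apexes-sound (ι ∘ suc) a xs ys (p ∘ suc)
  ... | true  with refl , refl ← bothColored-sound a x y eq =
    p zero refl refl ∷ apexes-sound (ι ∘ suc) a xs ys (p ∘ suc)

  newTriangles-mono : ∀ {a u v M} → Colored χ a u v → Extends χ M →
                      All (Mono χ) (newTriangles a u v M)
  newTriangles-mono {a} {u} {v} {M} c (extends col) =
    map⁺ (apexes-sound id a (lookup M u) (lookup M v) λ w p q → a , c , col u w p , col v w q)

  module _ (goal : Triple n → List (Triple n) → Bool) {A : Set}
           (goal-sound : ∀ {t ts} → T (goal t ts) → Mono χ t → All (Mono χ) ts → A) where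
    open Search goal

    -- At each edge the actual color in `χ` selects one of the two verified branches. Along this
    -- path `χ` extends `M` and all of `ts` is monochromatic. The path cannot run out of edges,
    -- where `search` is `false`, so it ends where the goal holds.
    search-sound : ∀ es {M ts} → All (λ (u , v) → u ≢ v) es → Extends χ M → All (Mono χ) ts →
                   T (search es M ts) → A
    branch-sound : ∀ es {a u v M ts} → All (λ (u , v) → u ≢ v) es → Colored χ a u v →
                   Extends χ M → All (Mono χ) ts → T (branch a u v es M ts) → A

    search-sound ((u , v) ∷ es) {M} {ts} (u≢v ∷ ≢s) ext monos s
      with color χ u v u≢v in eq | Equivalence.to (T-∧ {branch red u v es M ts}) s
    ... | red  | s-red , _  = branch-sound es ≢s (u≢v , eq) ext monos s-red
    ... | blue | _ , s-blue = branch-sound es ≢s (u≢v , eq) ext monos s-blue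

    branch-sound es {a} {u} {v} {M} {ts} ≢s c ext monos s
      with newTriangles-mono c ext
         | Equivalence.to (T-∨ {any (λ t → goal t ts) (newTriangles a u v M)}) s
    ... | new | inj₁ found with m , g ← All.lookupAny new (any⁻ _ _ found) = goal-sound g m monos
    ... | new | inj₂ rest = search-sound es ≢s (setEdge-extends c ext) (++⁺ new monos) rest

  -- From monochromatic triples to colored copies

  MonoIn-pairs : ∀ {a} t → MonoIn χ a t → ∀ i j → i ≢ j → Colored χ a (lookup t i) (lookup t j)
  MonoIn-pairs (_ ∷ _ ∷ _ ∷ []) (uv , uw , vw) = λ where
    zero             zero             i≢j → ⊥-elim (i≢j refl)
    zero             (suc zero)       _   → uv
    zero             (suc (suc zero)) _   → uw
    (suc zero)       zero             _   → Colored-sym uv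
    (suc zero)       (suc zero)       i≢j → ⊥-elim (i≢j refl)
    (suc zero)       (suc (suc zero)) _   → vw
    (suc (suc zero)) zero             _   → Colored-sym uw
    (suc (suc zero)) (suc zero)       _   → Colored-sym vw
    (suc (suc zero)) (suc (suc zero)) i≢j → ⊥-elim (i≢j refl)

  MonoIn⇒Copy : ∀ {a} t → MonoIn χ a t → Σ[ S ∈ Copy (K 3) (K n) ] HasColor χ a S
  MonoIn⇒Copy t m = S , λ i≢j → proj₂ (MonoIn-pairs t m _ _ i≢j)
    where
    S : Copy (K 3) (K n)
    S = record
      { embed     = lookup t
      ; injective = λ {i} {j} eq → decidable-stable (i ≟ j) λ i≢j → proj₁ (MonoIn-pairs t m i j i≢j) eq
      ; preserves = λ i≢j → proj₁ (MonoIn-pairs t m _ _ i≢j)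
      }

  Mono⇒ColoredCopy : ∀ {t} → Mono χ t → ColoredCopy (K 3) (K 3) χ
  Mono⇒ColoredCopy {t} (red  , m) = inj₁ (MonoIn⇒Copy t m)
  Mono⇒ColoredCopy {t} (blue , m) = inj₂ (MonoIn⇒Copy t m)

  Mono-vertex : ∀ {t} (m : Mono χ t) {w} → coloredVertexSet χ (Mono⇒ColoredCopy m) w →
                ∃[ i ] lookup t i ≡ w
  Mono-vertex (red  , _) = id
  Mono-vertex (blue , _) = id

  disjointPair : ∀ {s t} → Mono χ s → Mono χ t → T (disjoint s t) →
                 HasDisjointCopies (K 3) (K 3) 2 χ
  disjointPair {s} {t} m m′ d =
    cons {χ = χ} (Mono⇒ColoredCopy m) (cons {χ = χ} (Mono⇒ColoredCopy m′) none λ ()) λ { zero → dis }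
    where
    dis : coloredVertexSet χ (Mono⇒ColoredCopy m) ⊥ coloredVertexSet χ (Mono⇒ColoredCopy m′)
    dis (p , q) with i , eq ← Mono-vertex m p | j , eq′ ← Mono-vertex m′ q =
      disjoint-sound s t d i j (trans eq (sym eq′))

-- The upper bound

-- The classical Ramsey bound R(3,3) ≤ 6, obtained from the evaluated search.
triangle-K₆ : (χ : Coloring (K 6)) → ColoredCopy (K 3) (K 3) χ
triangle-K₆ χ = search-sound {χ = χ} anyTriangle (λ _ m _ → Mono⇒ColoredCopy m) edges₆
  {M = uncolored} {ts = []} (toWitness {a? = All.all? (λ (u , v) → ¬? (u ≟ v)) edges₆} tt)
  uncolored-extends [] search₆

triangle : ∀ {n} (χ : Coloring (K (6 + n))) → ColoredCopy (K 3) (K 3) χ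
triangle {n} χ = push S χ (triangle-K₆ (pull S χ))
  where
  S : Copy (K 6) (K (6 + n))
  S = copy (_↑ˡ n) (↑ˡ-injective n _ _)

two-triangles-012 : (χ : Coloring (K 8)) {a : Color} →
  Colored χ a (# 0) (# 1) → Colored χ a (# 0) (# 2) → Colored χ a (# 1) (# 2) →
  HasDisjointCopies (K 3) (K 3) 2 χ
two-triangles-012 χ {a} c₀₁ c₀₂ c₁₂ =
  search-sound disjointFromOne pair edges₈ {M = triangle₈ a} {ts = 012₈ ∷ []}
    (toWitness {a? = All.all? (λ (u , v) → ¬? (u ≟ v)) edges₈} tt)
    (setEdge-extends c₀₁ (setEdge-extends c₀₂ (setEdge-extends c₁₂ uncolored-extends)))
    ((a , c₀₁ , c₀₂ , c₁₂) ∷ []) (search₈ a)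
  where
  pair : ∀ {t ts} → T (disjointFromOne t ts) → Mono χ t → All (Mono χ) ts →
         HasDisjointCopies (K 3) (K 3) 2 χ
  pair found m monos with m′ , d ← All.lookupAny monos (any⁻ _ _ found) = disjointPair m m′ d

forces-2-8 : Forces (K 3) (K 3) 2 8
forces-2-8 χ with a , S , h ← monochromatic χ (triangle χ) with S′ , dis ← complement 3 S =
  -- On 0, 1, 2 the map of `σ` computes to the vertices of `S`, so `h` supplies the three colors of
  -- the starting triangle.
  pushAll σ χ (two-triangles-012 (pull σ χ) ((λ ()) , h (λ ())) ((λ ()) , h (λ ())) ((λ ()) , h (λ ())))
  where
  σ : Copy (K 8) (K 8)
  σ = union S S′ dis

-- The order `6 + n` is large enough for `triangle`, and read as `3 + (3 + n)` it leaves `3 + n`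
-- vertices after the triangle is removed.
forces-step : ∀ {k n} → Forces (K 3) (K 3) k (3 + n) → Forces (K 3) (K 3) (suc k) (6 + n)
forces-step ih χ with S′ , dis ← complement 3 (underlying χ (triangle χ)) =
  cons (triangle χ) (pushAll S′ χ D) λ i (p , q) →
    dis (coloredVertexSet⊆underlying χ (triangle χ) p , push-⊆ S′ χ (proj₁ D i) q)
  where
  D = ih (pull S′ χ)

-- With the factor 3 on the right, `suc j * 3` computes to `3 + j * 3`, which matches `forces-step`
-- without rewriting.
forces : ∀ j → Forces (K 3) (K 3) (2 + j) (8 + j * 3)
forces zero    = forces-2-8
forces (suc j) = forces-step (forces j)

-- The lower bound

0≢1 : _≢_ {A = Fin 3} (# 0) (# 1)
0≢1 ()

0≢2 : _≢_ {A = Fin 3} (# 0) (# 2)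
0≢2 ()

1≢2 : _≢_ {A = Fin 3} (# 1) (# 2)
1≢2 ()

low : ∀ {n} → Fin n → Bool
low zero          = true
low (suc zero)    = true
low (suc (suc _)) = false

agree : Bool → Bool → Color
agree false false = red
agree false true  = blue
agree true  false = blue
agree true  true  = red

agree-comm : ∀ b c → agree b c ≡ agree c b
agree-comm false false = refl
agree-comm false true  = refl
agree-comm true  false = refl
agree-comm true  true  = refl

lowSplit : ∀ n → Coloring (K n)
lowSplit n = record
  { color     = λ u v _ → agree (low u) (low v)
  ; color-sym = λ u v _ → agree-comm (low u) (low v)
  }

-- The blue graph of `lowSplit` is bipartite, so it contains no triangle.
not-all-disagree : ∀ b c d → agree b c ≡ blue → agree b d ≡ blue → agree c d ≢ blue
not-all-disagree false true false _ () _
not-all-disagree false true true  _ _  ()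
not-all-disagree true false false _ _  ()
not-all-disagree true false true  _ () _

agree-red : ∀ {b c} → agree b c ≡ red → b ≡ c
agree-red {false} {false} _ = refl
agree-red {true}  {true}  _ = refl

not-all-low : ∀ {n} (u v w : Fin n) → u ≢ v → u ≢ w → v ≢ w →
              low u ≡ true → low v ≡ true → low w ≢ true
not-all-low zero       zero       _          u≢v _   _   _ _ _ = u≢v refl
not-all-low (suc zero) (suc zero) _          u≢v _   _   _ _ _ = u≢v refl
not-all-low zero       (suc zero) zero       _   u≢w _   _ _ _ = u≢w refl
not-all-low zero       (suc zero) (suc zero) _   _   v≢w _ _ _ = v≢w refl
not-all-low (suc zero) zero       zero       _   _   v≢w _ _ _ = v≢w refl
not-all-low (suc zero) zero       (suc zero) _   u≢w _   _ _ _ = u≢w refl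

triangle-high : ∀ {n} (T : ColoredCopy (K 3) (K 3) (lowSplit n)) i →
                low (embed (underlying (lowSplit n) T) i) ≡ false
triangle-high (inj₂ (S , h)) _ = ⊥-elim (not-all-disagree _ _ _ (h 0≢1) (h 0≢2) (h 1≢2))
triangle-high (inj₁ (S , h)) i = all-high
  where
  -- Red edges stay on one side of the split, so one low vertex would make all three low, but only 0
  -- and 1 are low.
  all-low : low (embed S i) ≡ true → ∀ j → low (embed S j) ≡ true
  all-low eq j with j ≟ i
  ... | yes refl = eq
  ... | no  j≢i  = trans (agree-red (h j≢i)) eq

  all-high : low (embed S i) ≡ false
  all-high = ¬-not λ eq → not-all-low _ _ _ (preserves S 0≢1) (preserves S 0≢2) (preserves S 1≢2)
    (all-low eq (# 0)) (all-low eq (# 1)) (all-low eq (# 2))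

high : ∀ {n} (v : Fin (2 + n)) → low v ≡ false → Σ[ w ∈ Fin n ] v ≡ suc (suc w)
high (suc (suc w)) _ = w , refl

module _ {n k} (D : HasDisjointCopies (K 3) (K 3) k (lowSplit (2 + n))) where

  private
    χ : Coloring (K (2 + n))
    χ = lowSplit (2 + n)

    F : Fin k → ColoredCopy (K 3) (K 3) χ
    F = proj₁ D

  vertex : Fin 3 × Fin k → Fin (2 + n)
  vertex (i , j) = embed (underlying χ (F j)) i

  -- Within one triangle this is injectivity of the copy; between two triangles it is their
  -- disjointness.
  vertex-injective : Injective _≡_ _≡_ vertex
  vertex-injective {i , j} {i′ , j′} eq with j ≟ j′
  ... | yes refl = cong (_, j) (injective (underlying χ (F j)) eq)
  ... | no  j≢j′ = ⊥-elim (proj₂ D j j′ j≢j′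
    (underlying⊆coloredVertexSet χ (F j) (i , eq) , underlying⊆coloredVertexSet χ (F j′) (i′ , refl)))

  vertex-high : ∀ p → Σ[ w ∈ Fin n ] vertex p ≡ suc (suc w)
  vertex-high (i , j) = high _ (triangle-high (F j) i)

  -- The `3 * k` triangle vertices inject into the `n` vertices that remain without 0 and 1.
  3k≤n : 3 * k ≤ n
  3k≤n = injective⇒≤ {f = f} f-injective
    where
    f : Fin (3 * k) → Fin n
    f = proj₁ ∘ vertex-high ∘ remQuot {3} k

    f-injective : Injective _≡_ _≡_ f
    f-injective {x} {y} eq = remQuot-injective (vertex-injective (begin
      vertex (remQuot k x)  ≡⟨ proj₂ (vertex-high (remQuot k x)) ⟩
      suc (suc (f x))       ≡⟨ cong (λ w → suc (suc w)) eq ⟩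
      suc (suc (f y))       ≡⟨ proj₂ (vertex-high (remQuot k y)) ⟨
      vertex (remQuot k y)  ∎))
      where
      open ≡-Reasoning

      remQuot-injective : remQuot {3} k x ≡ remQuot k y → x ≡ y
      remQuot-injective eq =
        trans (sym (combine-remQuot {3} k x)) (trans (cong (uncurry combine) eq) (combine-remQuot {3} k y))

-- With `suc k` the family has a first triangle, which is what excludes the orders 0 and 1.
lower : ∀ k q → Forces (K 3) (K 3) (suc k) q → 3 * suc k + 2 ≤ q
lower k (suc (suc n)) F = ≤-trans (≤-reflexive (+-comm (3 * suc k) 2)) (s≤s (s≤s (3k≤n (F (lowSplit _)))))
-- `K 0` has no vertex for the first triangle, and the only vertex of `K 1` is low, against
-- `triangle-high`.
lower k 0 F with () ← embed (underlying (lowSplit 0) (proj₁ (F (lowSplit 0)) zero)) zero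
lower k 1 F with zero ← embed (underlying (lowSplit 1) (proj₁ (F (lowSplit 1)) zero)) zero
               | () ← triangle-high (proj₁ (F (lowSplit 1)) zero) zero

theorem3p7 : (k : ℕ) → k ≥ 2 → r[ K 3 , K 3 ∶ k ]≡ (3 * k + 2)
theorem3p7 (suc (suc j)) (s≤s (s≤s z≤n)) = subst (Forces (K 3) (K 3) (2 + j)) (order≡ j) (forces j) ,
                                           lower (suc j)
  where
  order≡ : ∀ j → 8 + j * 3 ≡ 3 * (2 + j) + 2
  order≡ = solve-∀
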